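{- For every fixed integer $k\ge 3$, as $n\to\infty$, \[ f(n,k)=(1+o(1))\left(\frac{n}{k-1}\right)^{k-1}. \]
   Context: An antichain in $2^{[n]}$ (where $[n]=\{1,\dots,n\}$) is a family of subsets of $[n]$ none of which is contained in another. There is an unknown antichain $\mathcal{S}\subseteq 2^{[n]}$ with exactly $k$ members. A query is a set $Q\subseteq[n]$, answered YES if $Q\supseteq S$ for some $S\in\mathcal{S}$ and NO otherwise. $f(n,k)$ is the smallest $q$ such that some adaptive strategy (queries may depend on previous answers) determines every $k$-member antichain $\mathcal{S}$ uniquely using at most $q$ queries in the worst case. -}

module Defs where

open import Data.Nat using (ℕ; zero; suc; _+_; _*_; _∸_; _^_; _≤_; _⊔_)
open import Data.Fin.Subset using (Subset; _⊆_)
open import Data.List using (List; length)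
open import Data.List.Membership.Propositional using (_∈_)
open import Data.List.Relation.Unary.Unique.Propositional using (Unique)
open import Data.Product using (_×_; ∃-syntax)
open import Relation.Binary.PropositionalEquality using (_≡_)
open import Relation.Nullary using (¬_)
open import Function.Bundles using (_⇔_)

Family : ℕ → Set
Family n = List (Subset n)

IsAntichain : (n k : ℕ) → Family n → Set
IsAntichain n k 𝒮 =
  length 𝒮 ≡ k × Unique 𝒮 ×
  (∀ {S T} → S ∈ 𝒮 → T ∈ 𝒮 → S ⊆ T → S ≡ T)

Yes : ∀ {n} → Family n → Subset n → Set
Yes 𝒮 Q = ∃[ S ] (S ∈ 𝒮 × S ⊆ Q)

-- An adaptive query strategy: a binary decision tree whose internal nodes
-- are queries; the left subtree is followed on YES, the right on NO.
data Strategy (n : ℕ) : Set where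
  leaf  : Strategy n
  query : Subset n → Strategy n → Strategy n → Strategy n

depth : ∀ {n} → Strategy n → ℕ
depth leaf = 0
depth (query _ y m) = suc (depth y ⊔ depth m)

data SameRun {n : ℕ} : Strategy n → Family n → Family n → Set where
  leaf : ∀ {𝒜 ℬ} → SameRun leaf 𝒜 ℬ
  yes  : ∀ {Q y m 𝒜 ℬ} → Yes 𝒜 Q → Yes ℬ Q → SameRun y 𝒜 ℬ →
         SameRun (query Q y m) 𝒜 ℬ
  no   : ∀ {Q y m 𝒜 ℬ} → ¬ Yes 𝒜 Q → ¬ Yes ℬ Q → SameRun m 𝒜 ℬ →
         SameRun (query Q y m) 𝒜 ℬ

Determines : (n k : ℕ) → Strategy n → Set
Determines n k t =
  ∀ 𝒜 ℬ → IsAntichain n k 𝒜 → IsAntichain n k ℬ → SameRun t 𝒜 ℬ →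
  ∀ S → (S ∈ 𝒜) ⇔ (S ∈ ℬ)

f≤ : ℕ → ℕ → ℕ → Set
f≤ n k q = ∃[ t ] (Determines n k t × depth t ≤ q)

{-# OPTIONS --safe #-}

-- Put d = k − 1. Lower bound: take d disjoint blocks of size b = ⌊n/d⌋ and, as the last member, the
-- complement of a transversal of the blocks. A query containing a block is always answered YES, and
-- any other query contains the complement of at most one transversal, so bᵈ − 1 queries are needed.
--
-- Upper bound: given known members K₁, …, Kⱼ with j < k, another member misses a point of each Kᵢ, so
-- it lies in the complement of a transversal of the Kᵢ; query these complements, and shrink a set
-- answered YES point by point to a new member. If two of the missed points can be taken equal, or if
-- j < d, then the complement of a set of at most k − 2 points suffices, and there are O(nᵏ⁻²) of these.
-- Otherwise j = d and the points come from disjoint sets, leaving at most (n/d)ᵈ choices by AM-GM.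

module Submission where

open import Defs renaming (yes to both-yes; no to both-no)
open import Data.Bool.Properties using () renaming (_≟_ to _≟ᵇ_)
open import Data.Empty using (⊥-elim)
open import Data.Fin using (Fin; zero; suc; combine; inject≤; finToFun; funToFin)
open import Data.Fin.Properties using (¬∀⟶∃¬; any?; _≟_; combine-injective; inject≤-injective; funToFin-finToFin)
open import Data.Fin.Subset using (Subset; ⊤; _⊆_; _-_; ⁅_⁆) renaming (_∈_ to _∈ˢ_; _∉_ to _∉ˢ_)
open import Data.Fin.Subset.Properties using (_∈?_; _⊆?_; ⊆-reflexive; ⊆-trans; ⊆-antisym; ⊆-max; p─q⊆p; x∈p∧x≢y⇒x∈p-y; drop-there)
open import Data.List as List using (List; []; _∷_; _++_; length; map; filter; allFin; cartesianProductWith)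
open import Data.List.Properties using (length-map; length-++; length-filter; length-tabulate; length-++-sucʳ)
open import Data.List.Membership.DecPropositional as DecMembership using ()
open import Data.List.Membership.Propositional using (_∈_; _∉_; find; lose)
open import Data.List.Membership.Propositional.Properties using (∈-filter⁺; ∈-filter⁻; ∈-allFin; ∈-tabulate⁺; ∈-tabulate⁻; ∈-++⁺ˡ; ∈-++⁺ʳ; ∈-++⁻; ∈-∃++; ∈-cartesianProductWith⁺)
open import Data.List.Relation.Binary.Subset.Propositional using () renaming (_⊆_ to _⊆ˡ_)
open import Data.List.Relation.Unary.All as All using (All; []; _∷_; all?)
open import Data.List.Relation.Unary.Any as Any using (here; there)
open import Data.List.Relation.Unary.Unique.Propositional using (Unique; []; _∷_)
open import Data.List.Relation.Unary.Unique.Propositional.Properties using (Unique[x∷xs]⇒x∉xs; tabulate⁺; filter⁺; allFin⁺)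
open import Data.Nat using (ℕ; zero; suc; _+_; _*_; _∸_; _^_; _/_; _≤_; _<_; _⊔_; z≤n; s≤s; NonZero; >-nonZero)
open import Data.Nat.DivMod using (m≡m%n+[m/n]*n; m%n<n; m/n*n≤m; /-monoˡ-≤; m*n/n≡m)
open import Data.Nat.Properties hiding (_≟_)
open import Data.Nat.Tactic.RingSolver using (solve-∀)
open import Data.Product using (_×_; _,_; proj₁; proj₂; ∃-syntax)
open import Data.Sum using (_⊎_; inj₁; inj₂)
open import Data.Vec using (_∷_; tabulate)
open import Data.Vec.Properties using (≡-dec; lookup∘tabulate; lookup⇒[]=; []=⇒lookup)
open import Function using (_∘_; id; case_of_)
open import Function.Bundles using (_⇔_; mk⇔; Equivalence)
open import Relation.Binary.Definitions using (DecidableEquality)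
open import Relation.Binary.PropositionalEquality using (_≡_; _≢_; refl; sym; trans; cong; cong₂; subst; module ≡-Reasoning)
open import Relation.Nullary using (¬_; Dec; yes; no; contradiction; ¬?; does)
open import Relation.Nullary.Decidable using (decidable-stable; dec-true; _×-dec_; _→-dec_)
open import Relation.Unary using (Decidable)

-- Arithmetic

m*n≤o⇒m≤o/n : ∀ m n o .{{_ : NonZero n}} → m * n ≤ o → m ≤ o / n
m*n≤o⇒m≤o/n m n o m*n≤o = subst (_≤ o / n) (m*n/n≡m m n) (/-monoˡ-≤ n m*n≤o)

^-distribʳ-* : ∀ a b n → (a * b) ^ n ≡ a ^ n * b ^ n
^-distribʳ-* a b zero    = refl
^-distribʳ-* a b (suc n) = trans (cong (a * b *_) (^-distribʳ-* a b n)) (interchange a b (a ^ n) (b ^ n))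
  where
  interchange : ∀ a b x y → a * b * (x * y) ≡ a * x * (b * y)
  interchange = solve-∀

-- Lowering `a` and `b` together reduces to the case where one is zero, so no difference a - b has
-- to be formed.
2ab≤a²+b² : ∀ a b → 2 * (a * b) ≤ a * a + b * b
2ab≤a²+b² zero    b       = z≤n
2ab≤a²+b² (suc a) zero    = ≤-trans (≤-reflexive (cong (2 *_) (*-zeroʳ a))) z≤n
2ab≤a²+b² (suc a) (suc b) = begin
  2 * (suc a * suc b)                     ≡⟨ lhs a b ⟩
  2 * (a * b) + 2 * (1 + a + b)           ≤⟨ +-monoˡ-≤ _ (2ab≤a²+b² a b) ⟩
  a * a + b * b + 2 * (1 + a + b)         ≡⟨ rhs a b ⟩
  suc a * suc a + suc b * suc b           ∎
  where
  open ≤-Reasoning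
  lhs : ∀ a b → 2 * (suc a * suc b) ≡ 2 * (a * b) + 2 * (1 + a + b)
  lhs = solve-∀
  rhs : ∀ a b → a * a + b * b + 2 * (1 + a + b) ≡ suc a * suc a + suc b * suc b
  rhs = solve-∀

-- By convexity the graph of the power 1 + d lies above its tangent at `b`; the negative term of the
-- tangent is moved to the other side.
tangent-^ : ∀ d a b → suc d * (a * b ^ d) ≤ a ^ suc d + d * b ^ suc d
tangent-^ zero    a b = ≤-reflexive (base a)
  where
  base : ∀ a → 1 * (a * 1) ≡ a * 1 + 0
  base = solve-∀
-- Adding the same d a bᵈ⁺¹ to both sides turns the left one into a multiple of 2ab.
tangent-^ (suc d) a b = +-cancelˡ-≤ (d * (a * (b * b ^ d))) _ _ (begin
  d * (a * (b * b ^ d)) + suc (suc d) * (a * (b * b ^ d))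
    ≡⟨ split d a b (b ^ d) ⟩
  suc d * b ^ d * (2 * (a * b))
    ≤⟨ *-monoʳ-≤ (suc d * b ^ d) (2ab≤a²+b² a b) ⟩
  suc d * b ^ d * (a * a + b * b)
    ≡⟨ regroup d a b (b ^ d) ⟩
  a * (suc d * (a * b ^ d)) + suc d * (b * (b * b ^ d))
    ≤⟨ +-monoˡ-≤ _ (*-monoʳ-≤ a (tangent-^ d a b)) ⟩
  a * (a * a ^ d + d * (b * b ^ d)) + suc d * (b * (b * b ^ d))
    ≡⟨ collect d a b (a ^ d) (b ^ d) ⟩
  d * (a * (b * b ^ d)) + (a * (a * a ^ d) + suc d * (b * (b * b ^ d))) ∎)
  where
  open ≤-Reasoning
  split : ∀ d a b p → d * (a * (b * p)) + suc (suc d) * (a * (b * p)) ≡ suc d * p * (2 * (a * b))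
  split = solve-∀
  regroup : ∀ d a b p → suc d * p * (a * a + b * b) ≡ a * (suc d * (a * p)) + suc d * (b * (b * p))
  regroup = solve-∀
  collect : ∀ d a b q p → a * (a * q + d * (b * p)) + suc d * (b * (b * p)) ≡
            d * (a * (b * p)) + (a * (a * q) + suc d * (b * (b * p)))
  collect = solve-∀

-- Weighted AM-GM, from the tangent inequality at a = d (x + s), b = (1 + d) s.
x*s^d-max : ∀ d x s → x * s ^ d * suc d ^ suc d ≤ d ^ d * (x + s) ^ suc d
x*s^d-max zero x s = begin
  x * 1 * 1              ≡⟨ trans (*-identityʳ _) (*-identityʳ x) ⟩
  x                      ≤⟨ m≤m+n x s ⟩
  x + s                  ≡⟨ trans (*-identityʳ _) (*-identityʳ _) ⟨
  (x + s) * 1 * 1        ≡⟨ *-comm ((x + s) * 1) 1 ⟩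
  1 * ((x + s) * 1)      ∎
  where open ≤-Reasoning
-- The tangent inequality yields the claim multiplied by `d`, so `d` has to be cancelled; hence the
-- separate case `d = 0`.
x*s^d-max d@(suc _) x s = *-cancelˡ-≤ d (+-cancelʳ-≤ (d * b ^ suc d) _ _ (begin
  d * (x * s ^ d * (suc d * suc d ^ d)) + d * (b * b ^ d)
    ≡⟨ cong (λ z → d * (x * s ^ d * (suc d * suc d ^ d)) + d * (b * z)) (^-distribʳ-* (suc d) s d) ⟩
  d * (x * s ^ d * (suc d * suc d ^ d)) + d * (suc d * s * (suc d ^ d * s ^ d))
    ≡⟨ factor d x s (suc d ^ d) (s ^ d) ⟩
  suc d * (a * (suc d ^ d * s ^ d))
    ≡⟨ cong (λ z → suc d * (a * z)) (^-distribʳ-* (suc d) s d) ⟨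
  suc d * (a * b ^ d)
    ≤⟨ tangent-^ d a b ⟩
  a ^ suc d + d * b ^ suc d
    ≡⟨ cong (_+ d * b ^ suc d) (trans (^-distribʳ-* d (x + s) (suc d)) (*-assoc d (d ^ d) _)) ⟩
  d * (d ^ d * (x + s) ^ suc d) + d * b ^ suc d ∎))
  where
  open ≤-Reasoning
  a = d * (x + s)
  b = suc d * s
  factor : ∀ d x s p q → d * (x * q * (suc d * p)) + d * (suc d * s * (p * q)) ≡
           suc d * (d * (x + s) * (p * q))
  factor = solve-∀

-- Induction step of AM-GM: `p` stands for a product of `d` factors with sum `s`, and `x` is one
-- more factor.
am-gm-step : ∀ d x s p → p * d ^ d ≤ s ^ d → x * p * suc d ^ suc d ≤ (x + s) ^ suc d
am-gm-step d x s p p≤ = *-cancelˡ-≤ (d ^ d) {{d^d≢0 d}} (begin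
  d ^ d * (x * p * suc d ^ suc d)   ≡⟨ swap (d ^ d) x p (suc d ^ suc d) ⟩
  x * (p * d ^ d) * suc d ^ suc d   ≤⟨ *-monoˡ-≤ (suc d ^ suc d) (*-monoʳ-≤ x p≤) ⟩
  x * s ^ d * suc d ^ suc d         ≤⟨ x*s^d-max d x s ⟩
  d ^ d * (x + s) ^ suc d           ∎)
  where
  open ≤-Reasoning
  -- The case `d = 0` is covered because 0⁰ = 1.
  d^d≢0 : ∀ d → NonZero (d ^ d)
  d^d≢0 zero      = _
  d^d≢0 d@(suc _) = m^n≢0 d d
  swap : ∀ c x p q → c * (x * p * q) ≡ x * (p * c) * q
  swap = solve-∀

-- A crude binomial bound. In the induction the error splits into three terms, each at most 3ᵉ⁺¹
-- bᵉ⁺¹, which is why the constant is a power of 3.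
[1+b]^[1+e]-≤ : ∀ e b → 1 ≤ b → suc b ^ suc e ≤ b ^ suc e + 3 ^ suc e * b ^ e
[1+b]^[1+e]-≤ zero    b 1≤b = begin
  suc b * 1             ≡⟨ lhs b ⟩
  b * 1 + 1             ≤⟨ +-monoʳ-≤ (b * 1) (s≤s z≤n) ⟩
  b * 1 + 3             ∎
  where
  open ≤-Reasoning
  lhs : ∀ b → suc b * 1 ≡ b * 1 + 1
  lhs = solve-∀
[1+b]^[1+e]-≤ (suc e) b 1≤b = begin
  suc b * suc b ^ suc e
    ≤⟨ *-monoʳ-≤ (suc b) ([1+b]^[1+e]-≤ e b 1≤b) ⟩
  suc b * (b * p + 3 * t * p)
    ≡⟨ expand b p t ⟩
  b * (b * p) + (3 * t * (b * p) + (1 * (b * p) + 3 * t * (1 * p)))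
    ≤⟨ +-monoʳ-≤ (b * (b * p)) (+-monoʳ-≤ (3 * t * (b * p))
         (+-mono-≤ (*-monoˡ-≤ (b * p) (*-mono-≤ (s≤s {n = 2} z≤n) (m^n>0 3 e)))
                   (*-monoʳ-≤ (3 * t) (*-monoˡ-≤ p 1≤b)))) ⟩
  b * (b * p) + (3 * t * (b * p) + (3 * t * (b * p) + 3 * t * (b * p)))
    ≡⟨ collect b p t ⟩
  b * (b * p) + 3 * (3 * t) * (b * p) ∎
  where
  open ≤-Reasoning
  p = b ^ e
  t = 3 ^ e
  expand : ∀ b p t → suc b * (b * p + 3 * t * p) ≡
           b * (b * p) + (3 * t * (b * p) + (1 * (b * p) + 3 * t * (1 * p)))
  expand = solve-∀
  collect : ∀ b p t → b * (b * p) + (3 * t * (b * p) + (3 * t * (b * p) + 3 * t * (b * p))) ≡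
            b * (b * p) + 3 * (3 * t) * (b * p)
  collect = solve-∀

-- `X` is the main term; the rest has order nᵉ and is absorbed by one extra nᵈ. In the threshold, 2
-- counts the two summands `suc n ^ e` and `n`, and `2 ^ e` comes from n + 1 ≤ 2n.
upper-estimate : ∀ e m n X → let d = suc e ; k = suc d in
  suc (m * k * 2 * 2 ^ e * d ^ d) ≤ n → n ≤ suc n ^ e → X * d ^ d ≤ n ^ d →
  m * (k * (suc n ^ e + n) + X) * d ^ d ≤ (m + 1) * n ^ d
upper-estimate e m n X N≤n n≤D X≤ = begin
  m * (k * (suc n ^ e + n) + X) * d ^ d
    ≤⟨ *-monoˡ-≤ (d ^ d) (*-monoʳ-≤ m (+-monoˡ-≤ X (*-monoʳ-≤ k (+-mono-≤ D≤ (≤-trans n≤D D≤))))) ⟩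
  m * (k * (2 ^ e * n ^ e + 2 ^ e * n ^ e) + X) * d ^ d
    ≡⟨ expand m k (2 ^ e) (n ^ e) X (d ^ d) ⟩
  m * k * 2 * 2 ^ e * d ^ d * n ^ e + m * (X * d ^ d)
    ≤⟨ +-mono-≤ (*-monoˡ-≤ (n ^ e) (≤-trans (n≤1+n _) N≤n)) (*-monoʳ-≤ m X≤) ⟩
  n * n ^ e + m * n ^ d
    ≡⟨ collect m (n * n ^ e) ⟩
  (m + 1) * n ^ d ∎
  where
  open ≤-Reasoning
  d = suc e
  k = suc d
  D≤ : suc n ^ e ≤ 2 ^ e * n ^ e
  D≤ = ≤-trans (^-monoˡ-≤ e (begin
         1 + n        ≤⟨ +-monoˡ-≤ n (≤-trans (s≤s z≤n) N≤n) ⟩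
         n + n        ≡⟨ cong (n +_) (+-identityʳ n) ⟨
         2 * n        ∎)) (≤-reflexive (^-distribʳ-* 2 n e))
  expand : ∀ m k t p X c → m * (k * (t * p + t * p) + X) * c ≡ m * k * 2 * t * c * p + m * (X * c)
  expand = solve-∀
  collect : ∀ m p → p + m * p ≡ (m + 1) * p
  collect = solve-∀

-- Two losses have to be absorbed: rounding n/d down to `b`, paid for by `suc m * 3 ^ d` in the
-- threshold, and the -1 in q ≥ bᵈ - 1, paid for by the further `suc m`.
lower-estimate : ∀ e m b n q → let d = suc e in
  n ≤ suc b * d → suc m * 3 ^ d + suc m ≤ b → b ^ d ≤ suc q →
  m * n ^ d ≤ suc m * q * d ^ d
lower-estimate e m b n q n≤ N≤b b^d≤ = begin
  m * n ^ d                    ≤⟨ *-monoʳ-≤ m (^-monoˡ-≤ d n≤) ⟩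
  m * (suc b * d) ^ d          ≡⟨ cong (m *_) (^-distribʳ-* (suc b) d d) ⟩
  m * (suc b ^ d * d ^ d)      ≡⟨ *-assoc m _ _ ⟨
  m * suc b ^ d * d ^ d        ≤⟨ *-monoˡ-≤ (d ^ d) main ⟩
  suc m * q * d ^ d            ∎
  where
  open ≤-Reasoning
  d = suc e
  1≤b : 1 ≤ b
  1≤b = ≤-trans (≤-trans (s≤s z≤n) (m≤n+m (suc m) (suc m * 3 ^ d))) N≤b
  b≢0 : NonZero b
  b≢0 = >-nonZero 1≤b
  expand : ∀ M t p → M * t * p + M * p ≡ (M * t + M) * p
  expand = solve-∀
  step : m * suc b ^ d + suc m ≤ suc m * b ^ d
  step = begin
    m * suc b ^ d + suc m
      ≤⟨ +-monoˡ-≤ (suc m) (*-monoʳ-≤ m ([1+b]^[1+e]-≤ e b 1≤b)) ⟩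
    m * (b * b ^ e + 3 ^ d * b ^ e) + suc m
      ≡⟨ regroup m (3 ^ d) (b ^ e) b ⟩
    (m * 3 ^ d * b ^ e + suc m * 1) + m * (b * b ^ e)
      ≤⟨ +-monoˡ-≤ _ (+-mono-≤ (*-monoˡ-≤ (b ^ e) (*-monoˡ-≤ (3 ^ d) (n≤1+n m)))
                                (*-monoʳ-≤ (suc m) (m^n>0 b {{b≢0}} e))) ⟩
    (suc m * 3 ^ d * b ^ e + suc m * b ^ e) + m * (b * b ^ e)
      ≡⟨ cong (_+ m * (b * b ^ e)) (expand (suc m) (3 ^ d) (b ^ e)) ⟩
    (suc m * 3 ^ d + suc m) * b ^ e + m * (b * b ^ e)
      ≤⟨ +-monoˡ-≤ _ (*-monoˡ-≤ (b ^ e) N≤b) ⟩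
    b * b ^ e + m * (b * b ^ e) ∎
    where
    regroup : ∀ m t p b → m * (b * p + t * p) + suc m ≡ (m * t * p + suc m * 1) + m * (b * p)
    regroup = solve-∀
  main : m * suc b ^ d ≤ suc m * q
  main = +-cancelʳ-≤ (suc m) _ _ (begin
    m * suc b ^ d + suc m     ≤⟨ step ⟩
    suc m * b ^ d             ≤⟨ *-monoʳ-≤ (suc m) b^d≤ ⟩
    suc m * suc q             ≡⟨ trans (*-suc (suc m) q) (+-comm (suc m) _) ⟩
    suc m * q + suc m         ∎)

-- Lists and subsets

private variable
  n : ℕ
  P Q S : Subset n
  𝒜 ℬ 𝒦 : Family n

length-cartesianProductWith : ∀ {A B C : Set} (g : A → B → C) xs ys →
  length (cartesianProductWith g xs ys) ≡ length xs * length ys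
length-cartesianProductWith g []       ys = refl
length-cartesianProductWith g (x ∷ xs) ys = begin
  length (map (g x) ys ++ cartesianProductWith g xs ys)
    ≡⟨ length-++ (map (g x) ys) ⟩
  length (map (g x) ys) + length (cartesianProductWith g xs ys)
    ≡⟨ cong₂ _+_ (length-map (g x) ys) (length-cartesianProductWith g xs ys) ⟩
  length ys + length xs * length ys ∎
  where open ≡-Reasoning

length-filter-¬ : ∀ {A : Set} {R : A → Set} (R? : Decidable R) xs →
  length (filter R? xs) + length (filter (¬? ∘ R?) xs) ≡ length xs
length-filter-¬ R? []       = refl
length-filter-¬ R? (x ∷ xs) with R? x
... | yes _ = cong suc (length-filter-¬ R? xs)
... | no  _ = trans (+-suc _ _) (cong suc (length-filter-¬ R? xs))

Unique-⊆⇒length≤ : ∀ {A : Set} {xs ys : List A} → Unique xs → xs ⊆ˡ ys → length xs ≤ length ys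
Unique-⊆⇒length≤ {xs = []}     _ _ = z≤n
Unique-⊆⇒length≤ {xs = x ∷ xs} x∷xs!@(_ ∷ xs!) x∷xs⊆ys
  with us , vs , refl ← ∈-∃++ (x∷xs⊆ys (here refl)) =
  subst (suc (length xs) ≤_) (sym (length-++-sucʳ us x vs)) (s≤s (Unique-⊆⇒length≤ xs! xs⊆us++vs))
  where
  xs⊆us++vs : xs ⊆ˡ us ++ vs
  xs⊆us++vs y∈xs with ∈-++⁻ us (x∷xs⊆ys (there y∈xs))
  ... | inj₁ y∈us         = ∈-++⁺ˡ y∈us
  ... | inj₂ (here refl)  = contradiction y∈xs (Unique[x∷xs]⇒x∉xs x∷xs!)
  ... | inj₂ (there y∈vs) = ∈-++⁺ʳ us y∈vs

_≟ˢ_ : DecidableEquality (Subset n)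
_≟ˢ_ = ≡-dec _≟ᵇ_

_∈ᶠ?_ : (S : Subset n) (𝒦 : Family n) → Dec (S ∈ 𝒦)
_∈ᶠ?_ = DecMembership._∈?_ _≟ˢ_

x∉p-x : (p : Subset n) (x : Fin n) → x ∉ˢ p - x
x∉p-x (_ ∷ p) zero    ()
x∉p-x (_ ∷ p) (suc x) x∈ = x∉p-x p x (drop-there x∈)

p⊆q∧x∉p⇒p⊆q-x : ∀ {x} → P ⊆ Q → x ∉ˢ P → P ⊆ Q - x
p⊆q∧x∉p⇒p⊆q-x p⊆q x∉p y∈p = x∈p∧x≢y⇒x∈p-y (p⊆q y∈p) λ where refl → x∉p y∈p

⊈⇒∃∉ : ¬ P ⊆ Q → ∃[ x ] (x ∈ˢ P × x ∉ˢ Q)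
⊈⇒∃∉ {P = P} {Q} P⊈Q
  with x , ¬x ← ¬∀⟶∃¬ _ (λ x → x ∈ˢ P → x ∈ˢ Q) (λ x → x ∈? P →-dec x ∈? Q) (λ h → P⊈Q (h _)) =
  x , decidable-stable (x ∈? P) (λ x∉P → ¬x λ x∈P → contradiction x∈P x∉P) , λ x∈Q → ¬x λ _ → x∈Q

-- Upper bound

-- If `Q` contains none of the known members 𝒦, a YES to `Q` must come from a member not yet known.
Avoids : Family n → Subset n → Set
Avoids 𝒦 Q = All (λ K → ¬ K ⊆ Q) 𝒦

avoids? : (𝒦 : Family n) → Decidable (Avoids 𝒦)
avoids? 𝒦 Q = all? (λ K → ¬? (K ⊆? Q)) 𝒦

Covered : Subset n → Family n → List (Subset n) → Set
Covered S 𝒦 𝒬 = ∃[ Q ] (Q ∈ 𝒬 × S ⊆ Q × Avoids 𝒦 Q)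

avoids-⊆ : P ⊆ Q → Avoids 𝒦 Q → Avoids 𝒦 P
avoids-⊆ P⊆Q = All.map λ K⊈Q K⊆P → K⊈Q (⊆-trans K⊆P P⊆Q)

x∈p⇒p⊈q-x : ∀ {x} → x ∈ˢ P → ¬ P ⊆ Q - x
x∈p⇒p⊈q-x {Q = Q} {x} x∈P P⊆ = x∉p-x Q x (P⊆ x∈P)

p-x⊆p : (p : Subset n) (x : Fin n) → p - x ⊆ p
p-x⊆p p x = p─q⊆p p ⁅ x ⁆

-- All sets whose complement has at most e elements (the list has repetitions).
coSmall : (n e : ℕ) → List (Subset n)
coSmall n zero    = ⊤ ∷ []
coSmall n (suc e) = coSmall n e ++ cartesianProductWith _-_ (coSmall n e) (allFin n)

length-coSmall : ∀ n e → length (coSmall n e) ≡ suc n ^ e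
length-coSmall n zero    = refl
length-coSmall n (suc e) = begin
  length (coSmall n (suc e))
    ≡⟨ length-++ (coSmall n e) ⟩
  length (coSmall n e) + length (cartesianProductWith _-_ (coSmall n e) (allFin n))
    ≡⟨ cong (length (coSmall n e) +_) (length-cartesianProductWith _-_ (coSmall n e) (allFin n)) ⟩
  length (coSmall n e) + length (coSmall n e) * length (allFin n)
    ≡⟨ cong₂ (λ l m → l + l * m) (length-coSmall n e) (length-tabulate {n = n} id) ⟩
  suc n ^ e + suc n ^ e * n
    ≡⟨ cong (suc n ^ e +_) (*-comm (suc n ^ e) n) ⟩
  suc n ^ suc e ∎
  where open ≡-Reasoning

coSmall-mono : ∀ {e e′} → e ≤ e′ → coSmall n e ⊆ˡ coSmall n e′
coSmall-mono {e = e} {e′} e≤e′ with m≤n⇒m<n∨m≡n e≤e′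
... | inj₂ refl        = id
... | inj₁ (s≤s e≤e″) = ∈-++⁺ˡ ∘ coSmall-mono e≤e″

coSmall-remove : ∀ e x → Q ∈ coSmall n e → Q - x ∈ coSmall n (suc e)
coSmall-remove e x Q∈ = ∈-++⁺ʳ (coSmall _ e) (∈-cartesianProductWith⁺ _-_ Q∈ (∈-allFin x))

-- Deleting a point of `K` that `S` misses spoils the inclusion of `K` and keeps that of `S`.
covered-remove : ∀ e {K x} → x ∈ˢ K → x ∉ˢ S →
  Covered S 𝒦 (coSmall n e) → Covered S (K ∷ 𝒦) (coSmall n (suc e))
covered-remove e {x = x} x∈K x∉S (Q , Q∈ , S⊆Q , avoids) =
  Q - x , coSmall-remove e x Q∈ , p⊆q∧x∉p⇒p⊆q-x S⊆Q x∉S ,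
  x∈p⇒p⊈q-x {Q = Q} x∈K ∷ avoids-⊆ (p-x⊆p Q x) avoids

coSmall-covers : ∀ 𝒦 → Avoids 𝒦 S → Covered S 𝒦 (coSmall n (length 𝒦))
coSmall-covers []      []              = ⊤ , here refl , ⊆-max _ , []
coSmall-covers (K ∷ 𝒦) (K⊈S ∷ avoids) with _ , x∈K , x∉S ← ⊈⇒∃∉ K⊈S =
  covered-remove (length 𝒦) x∈K x∉S (coSmall-covers 𝒦 avoids)

-- Deleting `x` spoils `K` and `L` at once, which saves one deletion. The recursion passes over the
-- other members, one deletion each, until it meets `L`.
coSmall-covers-shared : ∀ {x K L} → x ∈ˢ K → x ∉ˢ S → L ∈ 𝒦 → x ∈ˢ L → Avoids 𝒦 S →
  Covered S (K ∷ 𝒦) (coSmall n (length 𝒦))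
coSmall-covers-shared {𝒦 = L ∷ 𝒦} {x} x∈K x∉S (here refl) x∈L (_ ∷ avoids)
  with Q , Q∈ , S⊆Q , avoids′ ← coSmall-covers 𝒦 avoids =
  Q - x , coSmall-remove (length 𝒦) x Q∈ , p⊆q∧x∉p⇒p⊆q-x S⊆Q x∉S ,
  x∈p⇒p⊈q-x {Q = Q} x∈K ∷ x∈p⇒p⊈q-x {Q = Q} x∈L ∷ avoids-⊆ (p-x⊆p Q x) avoids′
coSmall-covers-shared {𝒦 = M ∷ 𝒦} x∈K x∉S (there L∈𝒦) x∈L (M⊈S ∷ avoids)
  with _ , y∈M , y∉S ← ⊈⇒∃∉ M⊈S
  with Q , Q∈ , S⊆Q , M⊈Q ∷ K⊈Q ∷ avoids′ ←
    covered-remove (length 𝒦) y∈M y∉S (coSmall-covers-shared x∈K x∉S L∈𝒦 x∈L avoids) =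
  Q , Q∈ , S⊆Q , K⊈Q ∷ M⊈Q ∷ avoids′

-- The i-th point is chosen outside the earlier members, so the ranges of the choices are disjoint
-- and AM-GM bounds their number.
coTransversals : List (Fin n) → Family n → List (Subset n)
coTransversals U []      = ⊤ ∷ []
coTransversals U (K ∷ 𝒦) =
  cartesianProductWith (λ x Q → Q - x) (filter (_∈? K) U) (coTransversals (filter (¬? ∘ (_∈? K)) U) 𝒦)

-- AM-GM by induction: filtering splits `U` into the choices for `K` and the points left for 𝒦, so
-- the two sizes add up to the length of `U`.
length-coTransversals : (U : List (Fin n)) (𝒦 : Family n) → let d = length 𝒦 in
  length (coTransversals U 𝒦) * d ^ d ≤ length U ^ d
length-coTransversals U []      = ≤-refl
length-coTransversals U (K ∷ 𝒦) = begin
  length (coTransversals U (K ∷ 𝒦)) * suc d ^ suc d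
    ≡⟨ cong (_* suc d ^ suc d) (length-cartesianProductWith _ (filter (_∈? K) U) _) ⟩
  length (filter (_∈? K) U) * length (coTransversals U′ 𝒦) * suc d ^ suc d
    ≤⟨ am-gm-step d (length (filter (_∈? K) U)) (length U′) _ (length-coTransversals U′ 𝒦) ⟩
  (length (filter (_∈? K) U) + length U′) ^ suc d
    ≡⟨ cong (_^ suc d) (length-filter-¬ (_∈? K) U) ⟩
  length U ^ suc d ∎
  where
  open ≤-Reasoning
  d = length 𝒦
  U′ = filter (¬? ∘ (_∈? K)) U

-- Either every point of a member of 𝒦 missing from S lies in no other member of 𝒦, so that no choice
-- is lost by making the ranges disjoint, or one missing point serves two members.
coTransversals-cover : ∀ (U : List (Fin n)) 𝒦 → Avoids 𝒦 S →
  (∀ {K x} → K ∈ 𝒦 → x ∈ˢ K → x ∉ˢ S → x ∈ U) →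
  Covered S 𝒦 (coTransversals U 𝒦) ⊎ ∃[ e ] (length 𝒦 ≡ suc e × Covered S 𝒦 (coSmall n e))
coTransversals-cover U [] [] _ = inj₁ (⊤ , here refl , ⊆-max _ , [])
coTransversals-cover {S = S} U (K ∷ 𝒦) (K⊈S ∷ avoids) missing⊆U
  with any? (λ x → x ∈? K ×-dec ¬? (x ∈? S) ×-dec Any.any? (x ∈?_) 𝒦)
... | yes (x , x∈K , x∉S , x∈⋃𝒦) with _ , L∈𝒦 , x∈L ← find x∈⋃𝒦 =
  inj₂ (length 𝒦 , refl , coSmall-covers-shared x∈K x∉S L∈𝒦 x∈L avoids)
... | no ¬shared with t , t∈K , t∉S ← ⊈⇒∃∉ K⊈S
  with coTransversals-cover (filter (¬? ∘ (_∈? K)) U) 𝒦 avoids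
    (λ L∈𝒦 x∈L x∉S → ∈-filter⁺ (¬? ∘ (_∈? K)) (missing⊆U (there L∈𝒦) x∈L x∉S)
      λ x∈K → ¬shared (_ , x∈K , x∉S , lose L∈𝒦 x∈L))
... | inj₁ (Q , Q∈ , S⊆Q , avoids′) =
  inj₁ (Q - t , ∈-cartesianProductWith⁺ (λ x Q → Q - x) (∈-filter⁺ (_∈? K) (missing⊆U (here refl) t∈K t∉S) t∈K) Q∈ ,
        p⊆q∧x∉p⇒p⊆q-x S⊆Q t∉S , x∈p⇒p⊈q-x {Q = Q} t∈K ∷ avoids-⊆ (p-x⊆p Q t) avoids′)
... | inj₂ (e , ∣𝒦∣≡1+e , covered) = inj₂ (suc e , cong suc ∣𝒦∣≡1+e , covered-remove e t∈K t∉S covered)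

-- Finding a set answered YES and shrinking it to a member

search : List (Subset n) → (Subset n → Strategy n) → Strategy n
-- A default: the leaf is not reached when some candidate contains a member.
search []      found = leaf
search (Q ∷ 𝒬) found = query Q (found Q) (search 𝒬 found)

depth-search : ∀ {b} 𝒬 (found : Subset n → Strategy n) → (∀ Q → depth (found Q) ≤ b) →
  depth (search 𝒬 found) ≤ length 𝒬 + b
depth-search []      found found≤ = z≤n
depth-search (Q ∷ 𝒬) found found≤ =
  s≤s (⊔-lub (≤-trans (found≤ Q) (m≤n+m _ (length 𝒬))) (depth-search 𝒬 found found≤))

search-sound : ∀ 𝒬 (found : Subset n → Strategy n) → SameRun (search 𝒬 found) 𝒜 ℬ →
  P ∈ 𝒬 → Yes 𝒜 P → ∃[ Q ] (Q ∈ 𝒬 × Yes 𝒜 Q × Yes ℬ Q × SameRun (found Q) 𝒜 ℬ)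
search-sound (Q ∷ 𝒬) found (both-yes 𝒜Q ℬQ run) _           _  = Q , here refl , 𝒜Q , ℬQ , run
search-sound (Q ∷ 𝒬) found (both-no ¬𝒜Q _ _)    (here refl) 𝒜P = contradiction 𝒜P ¬𝒜Q
search-sound (Q ∷ 𝒬) found (both-no _ _ run)    (there P∈𝒬) 𝒜P
  with R , R∈𝒬 , rest ← search-sound 𝒬 found run P∈𝒬 𝒜P = R , there R∈𝒬 , rest

minimise : Subset n → List (Fin n) → (Subset n → Strategy n) → Strategy n
minimise Q []       found = found Q
minimise Q (x ∷ xs) found = query (Q - x) (minimise (Q - x) xs found) (minimise Q xs found)

depth-minimise : ∀ {b} Q xs (found : Subset n → Strategy n) → (∀ S → depth (found S) ≤ b) →
  depth (minimise Q xs found) ≤ length xs + b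
depth-minimise Q []       found found≤ = found≤ Q
depth-minimise Q (x ∷ xs) found found≤ =
  s≤s (⊔-lub (depth-minimise (Q - x) xs found found≤) (depth-minimise Q xs found found≤))

-- For xs = [] this says that no member of 𝒜 is properly contained in Q.
MinimalUpTo : List (Fin n) → Family n → Subset n → Set
MinimalUpTo xs 𝒜 Q = ∀ {S x} → S ∈ 𝒜 → S ⊆ Q → x ∈ˢ Q → x ∉ˢ S → x ∈ xs

minimalUpTo-yes : ∀ {x xs} → MinimalUpTo (x ∷ xs) 𝒜 Q → MinimalUpTo xs 𝒜 (Q - x)
minimalUpTo-yes {Q = Q} {x} minimal S∈ S⊆ y∈ y∉S
  with minimal S∈ (⊆-trans S⊆ (p-x⊆p Q x)) (p-x⊆p Q x y∈) y∉S
... | here refl  = contradiction y∈ (x∉p-x Q x)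
... | there y∈xs = y∈xs

-- After a NO to `Q - x` every member inside `Q` contains `x`, so `x` need not be tried again.
minimalUpTo-no : ∀ {x xs} → ¬ Yes 𝒜 (Q - x) → MinimalUpTo (x ∷ xs) 𝒜 Q → MinimalUpTo xs 𝒜 Q
minimalUpTo-no ¬𝒜Q-x minimal S∈ S⊆Q y∈Q y∉S with minimal S∈ S⊆Q y∈Q y∉S
... | here refl  = ⊥-elim (¬𝒜Q-x (_ , S∈ , p⊆q∧x∉p⇒p⊆q-x S⊆Q y∉S))
... | there y∈xs = y∈xs

minimal⇒∈ : Yes 𝒜 Q → MinimalUpTo [] 𝒜 Q → Q ∈ 𝒜
minimal⇒∈ {𝒜 = 𝒜} (S , S∈ , S⊆Q) minimal = subst (_∈ 𝒜) (⊆-antisym S⊆Q Q⊆S) S∈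
  where
  Q⊆S : _ ⊆ S
  Q⊆S {x} x∈Q = decidable-stable (x ∈? S) λ x∉S → case minimal S∈ S⊆Q x∈Q x∉S of λ ()

minimise-sound : ∀ Q xs (found : Subset n → Strategy n) → SameRun (minimise Q xs found) 𝒜 ℬ →
  Yes 𝒜 Q → Yes ℬ Q → MinimalUpTo xs 𝒜 Q → MinimalUpTo xs ℬ Q →
  ∃[ S ] (S ⊆ Q × S ∈ 𝒜 × S ∈ ℬ × SameRun (found S) 𝒜 ℬ)
minimise-sound Q [] found run 𝒜Q ℬQ 𝒜min ℬmin =
  Q , id , minimal⇒∈ 𝒜Q 𝒜min , minimal⇒∈ ℬQ ℬmin , run
minimise-sound Q (x ∷ xs) found (both-yes 𝒜Q′ ℬQ′ run) _ _ 𝒜min ℬmin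
  with S , S⊆ , rest ← minimise-sound (Q - x) xs found run 𝒜Q′ ℬQ′
                         (minimalUpTo-yes 𝒜min) (minimalUpTo-yes ℬmin) =
  S , ⊆-trans S⊆ (p-x⊆p Q x) , rest
minimise-sound Q (x ∷ xs) found (both-no ¬𝒜Q′ ¬ℬQ′ run) 𝒜Q ℬQ 𝒜min ℬmin =
  minimise-sound Q xs found run 𝒜Q ℬQ (minimalUpTo-no ¬𝒜Q′ 𝒜min) (minimalUpTo-no ¬ℬQ′ ℬmin)

-- e = k − 2, and r is the number of members still missing after the one being searched for.
candidates : ℕ → ℕ → Family n → List (Subset n)
candidates {n} e zero    𝒦 = filter (avoids? 𝒦) (coSmall n e ++ coTransversals (allFin n) 𝒦)
candidates {n} e (suc r) 𝒦 = filter (avoids? 𝒦) (coSmall n e)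

candidates-avoid : ∀ e r (𝒦 : Family n) → Q ∈ candidates e r 𝒦 → Avoids 𝒦 Q
candidates-avoid {n} e zero    𝒦 Q∈ = proj₂ (∈-filter⁻ (avoids? 𝒦) {xs = coSmall n e ++ _} Q∈)
candidates-avoid {n} e (suc r) 𝒦 Q∈ = proj₂ (∈-filter⁻ (avoids? 𝒦) {xs = coSmall n e} Q∈)

candidates-cover : ∀ e r (𝒦 : Family n) → length 𝒦 + suc r ≡ suc (suc e) → Avoids 𝒦 S →
  ∃[ Q ] (Q ∈ candidates e r 𝒦 × S ⊆ Q)
candidates-cover {n} e zero 𝒦 ∣𝒦∣+1≡k avoids with coTransversals-cover (allFin n) 𝒦 avoids (λ _ _ _ → ∈-allFin _)
... | inj₁ (Q , Q∈ , S⊆Q , avoids′) =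
  Q , ∈-filter⁺ (avoids? 𝒦) (∈-++⁺ʳ (coSmall n e) Q∈) avoids′ , S⊆Q
... | inj₂ (e′ , ∣𝒦∣≡ , Q , Q∈ , S⊆Q , avoids′) =
  Q , ∈-filter⁺ (avoids? 𝒦) (∈-++⁺ˡ (subst (λ e → Q ∈ coSmall n e) e′≡e Q∈)) avoids′ , S⊆Q
  where
  e′≡e : e′ ≡ e
  e′≡e = suc-injective (suc-injective (trans (cong suc (sym ∣𝒦∣≡)) (trans (+-comm 1 (length 𝒦)) ∣𝒦∣+1≡k)))
candidates-cover {n} e (suc r) 𝒦 ∣𝒦∣+2+r≡k avoids
  with Q , Q∈ , S⊆Q , avoids′ ← coSmall-covers 𝒦 avoids =
  Q , ∈-filter⁺ (avoids? 𝒦) (coSmall-mono ∣𝒦∣≤e Q∈) avoids′ , S⊆Q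
  where
  ∣𝒦∣≤e : length 𝒦 ≤ e
  -- At least two members are still missing, so at most k - 2 are known and one deletion for each
  -- stays within `e`.
  ∣𝒦∣≤e = +-cancelʳ-≤ 2 _ _ (≤-trans (+-monoʳ-≤ (length 𝒦) (s≤s (s≤s z≤n)))
            (≤-reflexive (trans ∣𝒦∣+2+r≡k (+-comm 2 e))))

learn : ℕ → ℕ → Family n → Strategy n
learn e zero    𝒦 = leaf
learn e (suc r) 𝒦 =
  search (candidates e r 𝒦) λ Q → minimise Q (allFin _) λ S → learn e r (S ∷ 𝒦)

-- Correctness and depth of the strategy

fresh : Unique 𝒜 → length 𝒦 < length 𝒜 → ∃[ S ] (S ∈ 𝒜 × S ∉ 𝒦)
fresh {𝒜 = 𝒜} {𝒦} 𝒜! ∣𝒦∣<∣𝒜∣ with Any.any? (λ S → ¬? (S ∈ᶠ? 𝒦)) 𝒜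
... | yes some = find some
... | no  none = contradiction (Unique-⊆⇒length≤ 𝒜! 𝒜⊆𝒦) (<⇒≱ ∣𝒦∣<∣𝒜∣)
  where
  𝒜⊆𝒦 : 𝒜 ⊆ˡ 𝒦
  𝒜⊆𝒦 {S} S∈𝒜 = decidable-stable (S ∈ᶠ? 𝒦) (λ S∉𝒦 → none (lose S∈𝒜 S∉𝒦))

exhausted : Unique 𝒦 → 𝒦 ⊆ˡ 𝒜 → length 𝒜 ≤ length 𝒦 → 𝒜 ⊆ˡ 𝒦
exhausted {𝒦 = 𝒦} 𝒦! 𝒦⊆𝒜 ∣𝒜∣≤∣𝒦∣ {S} S∈𝒜 = decidable-stable (S ∈ᶠ? 𝒦) λ S∉𝒦 →
  contradiction (Unique-⊆⇒length≤ (All.tabulate (λ { T∈𝒦 refl → S∉𝒦 T∈𝒦 }) ∷ 𝒦!)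
                   (λ { (here refl) → S∈𝒜 ; (there T∈𝒦) → 𝒦⊆𝒜 T∈𝒦 }))
                (≤⇒≯ ∣𝒜∣≤∣𝒦∣)

-- Invariant: 𝒦 consists of distinct members common to 𝒜 and ℬ. Once there are k of them, both
-- families are exhausted by 𝒦.
learn-sound : ∀ e r (𝒦 : Family n) → length 𝒦 + r ≡ suc (suc e) →
  IsAntichain n (suc (suc e)) 𝒜 → IsAntichain n (suc (suc e)) ℬ →
  Unique 𝒦 → 𝒦 ⊆ˡ 𝒜 → 𝒦 ⊆ˡ ℬ → SameRun (learn e r 𝒦) 𝒜 ℬ → ∀ S → (S ∈ 𝒜) ⇔ (S ∈ ℬ)
learn-sound e zero 𝒦 ∣𝒦∣≡k (∣𝒜∣≡k , _) (∣ℬ∣≡k , _) 𝒦! 𝒦⊆𝒜 𝒦⊆ℬ _ S =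
  mk⇔ (𝒦⊆ℬ ∘ exhausted 𝒦! 𝒦⊆𝒜 (≤-reflexive (trans ∣𝒜∣≡k k≡∣𝒦∣)))
      (𝒦⊆𝒜 ∘ exhausted 𝒦! 𝒦⊆ℬ (≤-reflexive (trans ∣ℬ∣≡k k≡∣𝒦∣)))
  where k≡∣𝒦∣ = trans (sym ∣𝒦∣≡k) (+-identityʳ _)
learn-sound {n} e (suc r) 𝒦 ∣𝒦∣+≡k 𝒜-anti@(∣𝒜∣≡k , 𝒜! , 𝒜-⊆⇒≡) ℬ-anti 𝒦! 𝒦⊆𝒜 𝒦⊆ℬ run
  with T , T∈𝒜 , T∉𝒦 ← fresh {𝒦 = 𝒦} 𝒜! (subst (length 𝒦 <_) (trans ∣𝒦∣+≡k (sym ∣𝒜∣≡k)) (m<m+n _ (s≤s z≤n)))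
  -- The unknown member `T` contains no known one by the antichain property, so some candidate
  -- contains `T` and the search succeeds.
  with P , P∈ , T⊆P ← candidates-cover e r 𝒦 ∣𝒦∣+≡k
         (All.tabulate λ {K} K∈𝒦 K⊆T → T∉𝒦 (subst (_∈ 𝒦) (𝒜-⊆⇒≡ (𝒦⊆𝒜 K∈𝒦) T∈𝒜 K⊆T) K∈𝒦))
  with Q , Q∈ , 𝒜Q , ℬQ , run₁ ← search-sound (candidates e r 𝒦) _ run P∈ (T , T∈𝒜 , T⊆P)
  with S , S⊆Q , S∈𝒜 , S∈ℬ , run₂ ← minimise-sound Q (allFin n) _ run₁ 𝒜Q ℬQ
         (λ _ _ _ _ → ∈-allFin _) (λ _ _ _ _ → ∈-allFin _) =
  learn-sound e r (S ∷ 𝒦) (trans (sym (+-suc _ r)) ∣𝒦∣+≡k) 𝒜-anti ℬ-anti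
    -- `S` is new: it lies in `Q`, and `Q` contains no known member.
    (All.map (λ { K⊈Q refl → K⊈Q S⊆Q }) (candidates-avoid e r 𝒦 Q∈) ∷ 𝒦!)
    (λ { (here refl) → S∈𝒜 ; (there K∈𝒦) → 𝒦⊆𝒜 K∈𝒦 })
    (λ { (here refl) → S∈ℬ ; (there K∈𝒦) → 𝒦⊆ℬ K∈𝒦 })
    run₂

-- Each round costs (n + 1)ᵉ candidate queries and n shrinking queries. Only the last round asks
-- co-transversals, so `X` is added once.
depth-learn : ∀ e r (𝒦 : Family n) {X} → length 𝒦 + r ≡ suc (suc e) →
  (∀ (𝒦 : Family n) → length 𝒦 ≡ suc e → length (coTransversals (allFin n) 𝒦) ≤ X) →
  depth (learn e r 𝒦) ≤ r * (suc n ^ e + n) + X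
depth-learn e zero 𝒦 _ _ = z≤n
depth-learn {n} e (suc zero) 𝒦 {X} ∣𝒦∣+1≡k transversals≤ = begin
  depth (learn e 1 𝒦)
    ≤⟨ depth-search (candidates e 0 𝒦) _ (λ Q → depth-minimise Q (allFin n) _ (λ _ → z≤n)) ⟩
  length (candidates e 0 𝒦) + (length (allFin n) + 0)
    ≤⟨ +-monoˡ-≤ _ (length-filter (avoids? 𝒦) (coSmall n e ++ coTransversals (allFin n) 𝒦)) ⟩
  length (coSmall n e ++ coTransversals (allFin n) 𝒦) + (length (allFin n) + 0)
    ≡⟨ cong₂ (λ l m → l + (m + 0)) (length-++ (coSmall n e)) (length-tabulate {n = n} id) ⟩
  length (coSmall n e) + length (coTransversals (allFin n) 𝒦) + (n + 0)
    ≤⟨ +-monoˡ-≤ _ (+-mono-≤ (≤-reflexive (length-coSmall n e))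
         (transversals≤ 𝒦 (suc-injective (trans (+-comm 1 (length 𝒦)) ∣𝒦∣+1≡k)))) ⟩
  suc n ^ e + X + (n + 0)
    ≡⟨ regroup (suc n ^ e) X n ⟩
  1 * (suc n ^ e + n) + X ∎
  where
  open ≤-Reasoning
  regroup : ∀ D X n → D + X + (n + 0) ≡ 1 * (D + n) + X
  regroup = solve-∀
depth-learn {n} e (suc r@(suc _)) 𝒦 {X} ∣𝒦∣+≡k transversals≤ = begin
  depth (learn e (suc r) 𝒦)
    ≤⟨ depth-search (candidates e r 𝒦) _ (λ Q → depth-minimise Q (allFin n) _ (λ S →
         depth-learn e r (S ∷ 𝒦) (trans (sym (+-suc _ r)) ∣𝒦∣+≡k) transversals≤)) ⟩
  length (candidates e r 𝒦) + (length (allFin n) + (r * (suc n ^ e + n) + X))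
    ≤⟨ +-monoˡ-≤ _ (length-filter (avoids? 𝒦) (coSmall n e)) ⟩
  length (coSmall n e) + (length (allFin n) + (r * (suc n ^ e + n) + X))
    ≡⟨ cong₂ (λ l m → l + (m + (r * (suc n ^ e + n) + X))) (length-coSmall n e) (length-tabulate {n = n} id) ⟩
  suc n ^ e + (n + (r * (suc n ^ e + n) + X))
    ≡⟨ regroup (suc n ^ e) n (r * (suc n ^ e + n)) X ⟩
  suc r * (suc n ^ e + n) + X ∎
  where
  open ≤-Reasoning
  regroup : ∀ D n R X → D + (n + (R + X)) ≡ D + n + R + X
  regroup = solve-∀

upper-bound : ∀ e n → 1 ≤ e → let d = suc e ; k = suc d in
  ∀ m → suc (m * k * 2 * 2 ^ e * d ^ d) ≤ n →
  ∃[ q ] (f≤ n k q × m * q * d ^ d ≤ (m + 1) * n ^ d)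
upper-bound e n 1≤e m N≤n =
  q , (learn e k [] ,
       (λ 𝒜 ℬ 𝒜-anti ℬ-anti → learn-sound e k [] refl 𝒜-anti ℬ-anti [] (λ ()) (λ ())) ,
       depth-learn e k [] refl transversals≤X) ,
  upper-estimate e m n X N≤n n≤[1+n]^e (m/n*n≤m (n ^ d) (d ^ d))
  where
  d = suc e
  k = suc d
  instance
    d^d≢0 : NonZero (d ^ d)
    d^d≢0 = m^n≢0 d d
  X = n ^ d / d ^ d
  q = k * (suc n ^ e + n) + X
  transversals≤X : ∀ (𝒦 : Family n) → length 𝒦 ≡ d → length (coTransversals (allFin n) 𝒦) ≤ X
  transversals≤X 𝒦 ∣𝒦∣≡d = m*n≤o⇒m≤o/n _ (d ^ d) (n ^ d)
    (subst (λ d → length (coTransversals (allFin n) 𝒦) * d ^ d ≤ n ^ d) ∣𝒦∣≡d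
      (subst (λ l → length (coTransversals (allFin n) 𝒦) * length 𝒦 ^ length 𝒦 ≤ l ^ length 𝒦)
        (length-tabulate {n = n} id) (length-coTransversals (allFin n) 𝒦)))
  -- Here k ≥ 3 enters: with e ≥ 1 the n shrinking queries of a round are no more than its (n + 1)ᵉ
  -- candidates.
  n≤[1+n]^e : n ≤ suc n ^ e
  n≤[1+n]^e = ≤-trans (n≤1+n n) (subst (_≤ suc n ^ e) (^-identityʳ (suc n)) (^-monoʳ-≤ (suc n) 1≤e))

-- Lower bound

comprehension : ∀ {n} {R : Fin n → Set} → Decidable R → Subset n
comprehension R? = tabulate (does ∘ R?)

module _ {n} {R : Fin n → Set} (R? : Decidable R) where

  ∈-comprehension⁺ : ∀ {x} → R x → x ∈ˢ comprehension R?
  ∈-comprehension⁺ {x} Rx = lookup⇒[]= x _ (trans (lookup∘tabulate _ x) (dec-true (R? x) Rx))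

  ∈-comprehension⁻ : ∀ {x} → x ∈ˢ comprehension R? → R x
  ∈-comprehension⁻ {x} x∈ with R? x | trans (sym (lookup∘tabulate (does ∘ R?) x)) ([]=⇒lookup x∈)
  ... | yes Rx | _ = Rx

finToFun-injective : ∀ {b d} {s t : Fin (b ^ d)} → (∀ i → finToFun {b} {d} s i ≡ finToFun t i) → s ≡ t
finToFun-injective {b} {d} {s} {t} s≗t = trans (sym (funToFin-finToFin {d} {b} s))
  (trans (funToFin-cong d s≗t) (funToFin-finToFin {d} {b} t))
  where
  funToFin-cong : ∀ d {f g : Fin d → Fin b} → (∀ i → f i ≡ g i) → funToFin f ≡ funToFin g
  funToFin-cong zero    f≗g = refl
  funToFin-cong (suc d) f≗g = cong₂ combine (f≗g zero) (funToFin-cong d (f≗g ∘ suc))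

∃≢ : ∀ {n} → 2 ≤ n → (i : Fin n) → ∃[ j ] i ≢ j
∃≢ (s≤s (s≤s _)) zero    = suc zero , λ ()
∃≢ (s≤s (s≤s _)) (suc i) = zero , λ ()

module Adversary {n b d : ℕ} (d*b≤n : d * b ≤ n) (2≤b : 2 ≤ b) (2≤d : 2 ≤ d) where

  point : Fin d → Fin b → Fin n
  point i x = inject≤ (combine i x) d*b≤n

  point-injective : ∀ {i x j y} → point i x ≡ point j y → i ≡ j × x ≡ y
  point-injective {i} {x} {j} {y} eq =
    combine-injective i x j y (inject≤-injective d*b≤n d*b≤n _ _ eq)

  in-block? : ∀ i → Decidable (λ z → ∃[ x ] z ≡ point i x)
  in-block? i z = any? (λ x → z ≟ point i x)

  block : Fin d → Subset n
  block i = comprehension (in-block? i)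

  on-transversal? : ∀ (t : Fin (b ^ d)) → Decidable (λ z → ∃[ i ] z ≡ point i (finToFun t i))
  on-transversal? t z = any? (λ i → z ≟ point i (finToFun t i))

  -- A transversal is a number below bᵈ, decoded by `finToFun` into its position in each block.
  -- Points of [n] outside all blocks belong to every co-transversal.
  coTransversal : Fin (b ^ d) → Subset n
  coTransversal t = comprehension (¬? ∘ on-transversal? t)

  point∈block : ∀ i x → point i x ∈ˢ block i
  point∈block i x = ∈-comprehension⁺ (in-block? i) (x , refl)

  point∈block⇒≡ : ∀ {i j x} → point i x ∈ˢ block j → i ≡ j
  point∈block⇒≡ {j = j} p∈ = proj₁ (point-injective (proj₂ (∈-comprehension⁻ (in-block? j) p∈)))

  point∈coTransversal : ∀ t {i x} → finToFun t i ≢ x → point i x ∈ˢ coTransversal t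
  point∈coTransversal t {i} {x} ti≢x = ∈-comprehension⁺ (¬? ∘ on-transversal? t) off
    where
    off : ¬ (∃[ j ] point i x ≡ point j (finToFun t j))
    off (j , eq) with refl , refl ← point-injective eq = ti≢x refl

  point∉coTransversal : ∀ t i → point i (finToFun t i) ∉ˢ coTransversal t
  point∉coTransversal t i p∈ = ∈-comprehension⁻ (¬? ∘ on-transversal? t) p∈ (i , refl)

  block⊈coTransversal : ∀ t i → ¬ block i ⊆ coTransversal t
  block⊈coTransversal t i block⊆ = point∉coTransversal t i (block⊆ (point∈block i _))

  -- As 2 ≤ d there is another block, and as 2 ≤ b it has a point off the transversal.
  coTransversal⊈block : ∀ t i → ¬ coTransversal t ⊆ block i
  coTransversal⊈block t i coT⊆
    with j , i≢j ← ∃≢ 2≤d i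
    with x , tj≢x ← ∃≢ 2≤b (finToFun t j) =
    i≢j (sym (point∈block⇒≡ (coT⊆ (point∈coTransversal t tj≢x))))

  block-⊆⇒≡ : ∀ {i j} → block i ⊆ block j → i ≡ j
  block-⊆⇒≡ {i} block⊆ = point∈block⇒≡ (block⊆ (point∈block i (some 2≤b)))
    where
    some : ∀ {b} → 2 ≤ b → Fin b
    some (s≤s _) = zero

  family : Fin (b ^ d) → Family n
  family t = coTransversal t ∷ List.tabulate block

  family-antichain : ∀ t → IsAntichain n (suc d) (family t)
  family-antichain t =
    cong suc (length-tabulate block) ,
    All.tabulate coTransversal≢ ∷ tabulate⁺ (block-⊆⇒≡ ∘ ⊆-reflexive) ,
    antichain
    where
    coTransversal≢ : ∀ {S} → S ∈ List.tabulate block → coTransversal t ≢ S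
    coTransversal≢ S∈ eq with i , refl ← ∈-tabulate⁻ S∈ = coTransversal⊈block t i (⊆-reflexive eq)
    antichain : ∀ {S T} → S ∈ family t → T ∈ family t → S ⊆ T → S ≡ T
    antichain (here refl) (here refl) _ = refl
    antichain (here refl) (there T∈) S⊆T with i , refl ← ∈-tabulate⁻ T∈ =
      ⊥-elim (coTransversal⊈block t i S⊆T)
    antichain (there S∈) (here refl) S⊆T with i , refl ← ∈-tabulate⁻ S∈ =
      ⊥-elim (block⊈coTransversal t i S⊆T)
    antichain (there S∈) (there T∈) S⊆T with i , refl ← ∈-tabulate⁻ S∈ | j , refl ← ∈-tabulate⁻ T∈ =
      cong block (block-⊆⇒≡ S⊆T)

  -- Distinct transversals differ in some block, and there each point is off at least one of them.
  block⊆∪ : ∀ {s t Q} → s ≢ t → coTransversal s ⊆ Q → coTransversal t ⊆ Q → ∃[ i ] block i ⊆ Q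
  block⊆∪ {s} {t} {Q} s≢t s⊆Q t⊆Q
    with i , si≢ti ← ¬∀⟶∃¬ d _ (λ i → finToFun s i ≟ finToFun t i) (s≢t ∘ finToFun-injective {b} {d}) =
    i , block⊆Q
    where
    block⊆Q : block i ⊆ Q
    block⊆Q z∈ with x , refl ← ∈-comprehension⁻ (in-block? i) z∈ with finToFun s i ≟ x
    ... | no  si≢x = s⊆Q (point∈coTransversal s si≢x)
    ... | yes refl = t⊆Q (point∈coTransversal t (si≢ti ∘ sym))

  -- The adversary's answers

  survivors : Subset n → List (Fin (b ^ d)) → List (Fin (b ^ d))
  survivors Q = filter (λ t → ¬? (coTransversal t ⊆? Q))

  length-survivors : ∀ {Q ts} → ¬ (∃[ i ] block i ⊆ Q) → Unique ts →
    length ts ≤ suc (length (survivors Q ts))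
  length-survivors {Q} {ts} no-block ts! = subst (_≤ suc (length (survivors Q ts)))
    (length-filter-¬ killed? ts)
    (+-monoˡ-≤ (length (survivors Q ts))
      (at-most-one (filter⁺ killed? ts!) λ t∈ → proj₂ (∈-filter⁻ killed? {xs = ts} t∈)))
    where
    killed? : Decidable (λ t → coTransversal t ⊆ Q)
    killed? t = coTransversal t ⊆? Q
    at-most-one : ∀ {us} → Unique us → (∀ {t} → t ∈ us → coTransversal t ⊆ Q) → length us ≤ 1
    at-most-one []                   _  = z≤n
    at-most-one (_ ∷ [])             _  = s≤s z≤n
    at-most-one ((s≢t ∷ _) ∷ _ ∷ _) us⊆ =
      ⊥-elim (no-block (block⊆∪ s≢t (us⊆ (here refl)) (us⊆ (there (here refl)))))

  -- The adversary says YES exactly when the query contains a block. A YES then holds for all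
  -- families and eliminates none; a NO eliminates at most one, by `length-survivors`. So two
  -- transversals are left at the end.
  indistinguishable : ∀ (σ : Strategy n) {ts} → Unique ts → suc (depth σ) < length ts →
    ∃[ s ] ∃[ t ] (s ∈ ts × t ∈ ts × s ≢ t × SameRun σ (family s) (family t))
  indistinguishable leaf {_ ∷ _ ∷ _} ((s≢t ∷ _) ∷ _) _ =
    _ , _ , here refl , there (here refl) , s≢t , leaf
  indistinguishable leaf {_ ∷ []} _ (s≤s ())
  indistinguishable (query Q σʸ σⁿ) {ts} ts! depth< with any? (λ i → block i ⊆? Q)
  ... | yes (i , block⊆Q)
    with s , t , s∈ , t∈ , s≢t , run ← indistinguishable σʸ ts!
           (≤-trans (s≤s (s≤s (≤-trans (m≤m⊔n _ _) (n≤1+n _)))) depth<) =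
    s , t , s∈ , t∈ , s≢t , both-yes yes-block yes-block run
    where
    yes-block : ∀ {s} → Yes (family s) Q
    yes-block = block i , there (∈-tabulate⁺ i) , block⊆Q
  ... | no no-block
    with s , t , s∈ , t∈ , s≢t , run ← indistinguishable σⁿ (filter⁺ _ ts!)
           (≤-trans (s≤s (s≤s (m≤n⊔m (depth σʸ) _))) (≤-pred (≤-trans depth< (length-survivors {Q} no-block ts!)))) =
    s , t , proj₁ (survivor s∈) , proj₁ (survivor t∈) , s≢t ,
    both-no (says-no (proj₂ (survivor s∈))) (says-no (proj₂ (survivor t∈))) run
    where
    survivor : ∀ {t} → t ∈ survivors Q ts → t ∈ ts × ¬ coTransversal t ⊆ Q
    survivor = ∈-filter⁻ _ {xs = ts}
    says-no : ∀ {t} → ¬ coTransversal t ⊆ Q → ¬ Yes (family t) Q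
    says-no coT⊈Q (_ , here refl , coT⊆Q) = coT⊈Q coT⊆Q
    says-no coT⊈Q (_ , there S∈ , S⊆Q) with i , refl ← ∈-tabulate⁻ S∈ = no-block (i , S⊆Q)

  b^d≤1+depth : ∀ σ → Determines n (suc d) σ → b ^ d ≤ suc (depth σ)
  b^d≤1+depth σ determines = ≮⇒≥ λ depth< →
    let s , t , _ , _ , s≢t , run = indistinguishable σ (allFin⁺ (b ^ d))
          (subst (suc (depth σ) <_) (sym (length-tabulate {n = b ^ d} id)) depth<)
    in conclude s≢t (Equivalence.to
         (determines (family s) (family t) (family-antichain s) (family-antichain t) run (coTransversal s))
         (here refl))
    where
    conclude : ∀ {s t} → s ≢ t → ¬ coTransversal s ∈ family t
    conclude {s} {t} s≢t (here eq)
      -- Were the two co-transversals equal, their union would be a co-transversal containing a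
      -- block.
      with i , block⊆ ← block⊆∪ s≢t (⊆-reflexive eq) id = block⊈coTransversal t i block⊆
    conclude {s} _ (there coT∈) with i , eq ← ∈-tabulate⁻ coT∈ =
      coTransversal⊈block s i (⊆-reflexive eq)

lower-bound : ∀ e n → 1 ≤ e → let d = suc e in
  ∀ m → (suc m * 3 ^ d + suc m) * d ≤ n → ∀ σ → Determines n (suc d) σ →
  m * n ^ d ≤ suc m * depth σ * d ^ d
lower-bound e n 1≤e m N≤n σ determines =
  lower-estimate e m b n (depth σ) n≤[1+b]d N≤b
    (Adversary.b^d≤1+depth d*b≤n (≤-trans 2≤N N≤b) (s≤s 1≤e) σ determines)
  where
  d = suc e
  b = n / d
  d*b≤n : d * b ≤ n
  d*b≤n = subst (_≤ n) (*-comm b d) (m/n*n≤m n d)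
  n≤[1+b]d : n ≤ suc b * d
  n≤[1+b]d = ≤-trans (≤-reflexive (m≡m%n+[m/n]*n n d)) (+-monoˡ-≤ (b * d) (<⇒≤ (m%n<n n d)))
  N≤b : suc m * 3 ^ d + suc m ≤ b
  N≤b = m*n≤o⇒m≤o/n _ d n N≤n
  -- The threshold also forces b ≥ 2, as the adversary requires.
  2≤N : 2 ≤ suc m * 3 ^ d + suc m
  2≤N = +-mono-≤ (*-mono-≤ {1} {suc m} (s≤s z≤n) (m^n>0 3 d)) (s≤s z≤n)

theorem1p5 : ∀ k → 3 ≤ k →
    ∀ m → 1 ≤ m → ∃[ N ] ∀ n → N ≤ n →
    (∃[ q ] (f≤ n k q × m * q * (k ∸ 1) ^ (k ∸ 1) ≤ (m + 1) * n ^ (k ∸ 1)))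
    × (∀ t → Determines n k t →
    (m ∸ 1) * n ^ (k ∸ 1) ≤ m * depth t * (k ∸ 1) ^ (k ∸ 1))
-- Here k = e + 2, and the bounds have relative error 1/M with M the successor of the matched `m`;
-- `N₁` serves the upper bound and `N₂` the lower one.
theorem1p5 (suc (suc e)) (s≤s (s≤s 1≤e)) (suc m) _ = N₁ ⊔ N₂ , λ n N≤n →
  upper-bound e n 1≤e (suc m) (≤-trans (m≤m⊔n N₁ N₂) N≤n) ,
  lower-bound e n 1≤e m (≤-trans (m≤n⊔m N₁ N₂) N≤n)
  where
  d = suc e
  N₁ = suc (suc m * suc d * 2 * 2 ^ e * d ^ d)
  N₂ = (suc m * 3 ^ d + suc m) * d
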